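{- Let $\sigma$ be a finite relational signature. For every integer $d\ge1$ there are $\mathrm{FO}[\sigma]$-formulae $\epsilon_d(x,y)$ and $\alpha_d(x,y)$ such that for every finite $\sigma$-structure $\mathfrak A$ of tree-depth at most $d$: 1. $\epsilon_d$ defines an equivalence relation ${\sim_{\mathfrak A}}:=\{(u,v):\mathfrak A\models\epsilon_d[u,v]\}$ on the universe $A$ of $\mathfrak A$; 2. the equivalence classes of $\sim_{\mathfrak A}$ have size bounded by a function of $d$; 3. the relation defined by $\alpha_d$ is invariant under $\sim_{\mathfrak A}$, i.e. if $u\sim_{\mathfrak A}u'$ and $v\sim_{\mathfrak A}v'$, then $\mathfrak A\models\alpha_d[u,v]$ iff $\mathfrak A\models\alpha_d[u',v']$; 4. $\alpha_d$ defines a rooted tree structure on the quotient $\mathfrak A/{\sim_{\mathfrak A}}$, in which $[u]_{\sim_{\mathfrak A}}$ is an ancestor of $[v]_{\sim_{\mathfrak A}}$ or vice versa whenever $u,v\in A$ are adjacent in the Gaifman graph of $\mathfrak A$. This can be turned into a bounded-depth tree-decomposition of $\mathfrak A$ in the usual sense by taking the tree structure on $\mathfrak A/{\sim_{\mathfrak A}}$ as the tree and the set $\{v : [v]_{\sim_{\mathfrak A}}\text{ is an ancestor of }[u]_{\sim_{\mathfrak A}}\}$ as the bag of the node $[u]_{\sim_{\mathfrak A}}$.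
   Context: $\mathrm{FO}$ is first-order logic. $[u]_{\sim_{\mathfrak A}}$ denotes the equivalence class of $u$. A node of a rooted tree counts as an ancestor of itself. The Gaifman graph of a $\sigma$-structure $\mathfrak A$ has the universe $A$ as vertex set, with an edge between distinct $x,y$ iff they occur together in a tuple of some relation of $\mathfrak A$. Tree-depth: for a finite simple graph $G$, $\operatorname{td}(G)=1$ if $|V(G)|=1$; $\operatorname{td}(G)=1+\min_{r\in V(G)}\operatorname{td}(G\setminus r)$ if $G$ is connected and $|V(G)|>1$; $\operatorname{td}(G)=\max_i \operatorname{td}(K_i)$ if $G$ is disconnected with components $K_1,\dots,K_n$. The tree-depth of a structure is that of its Gaifman graph. A tree-decomposition of $\mathfrak A$ is a tree together with a set of elements of $A$ (a bag) for each tree node, such that any two elements adjacent in the Gaifman graph lie in a common bag and, for each element of $A$, the nodes whose bags contain it form a nonempty connected subtree. Bounded-depth means that the depth of the (rooted) tree is bounded in terms of $d$.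
   Formalization: As stated, item 4 fails for many isolated points with empty relations; proved instead: a rooted forest always, a rooted tree if the Gaifman graph is connected; the tree-decomposition lives on the quotient if connected, and in general after adding an extra root with empty bag. -}

module Defs where

open import Level using (0ℓ)
open import Data.Bool using (Bool; true)
open import Data.Empty using (⊥)
open import Data.Fin using (Fin)
open import Data.Fin.Subset using (Subset; Nonempty; ∣_∣; _∈_; _⊆_; _-_; ⊤)
open import Data.List using (List; length)
open import Data.List.Relation.Unary.Linked using (Linked)
open import Data.Nat using (ℕ; suc; _≤_; _<_)
open import Data.Product using (∃-syntax; _×_; _,_)
open import Data.Sum using (_⊎_)
open import Data.Vec using (Vec; []; _∷_; lookup; map)
import Data.Vec.Membership.Propositional as Vec
open import Function.Bundles using (_⇔_)
open import Relation.Binary.Construct.Closure.ReflexiveTransitive using (Star)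
open import Relation.Binary.Construct.NonStrictToStrict using () renaming (_<_ to Strict)
open import Relation.Binary.Core using (Rel; REL)
open import Relation.Binary.Structures using (IsPartialOrder)
open import Relation.Binary.PropositionalEquality using (_≡_; _≢_; sym; refl)
open import Relation.Nullary using (¬_)
open import Relation.Nullary.Construct.Add.Infimum using (_₋; ⊥₋; [_])

------------------------------------------------------------------------
-- First-order logic over finite relational structures

record Signature : Set where
  field
    numRel : ℕ
    arity  : Fin numRel → ℕ

open Signature public

-- Relations are Bool-valued: classically, arbitrary relations.
record Structure (σ : Signature) : Set where
  field
    size   : ℕ
    interp : (R : Fin (numRel σ)) → Vec (Fin size) (arity σ R) → Bool

  Universe : Set
  Universe = Fin size

open Structure public

-- Formula σ n: formulae with free variables among n de Bruijn indices;
-- a quantifier binds the new index zero.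
data Formula (σ : Signature) (n : ℕ) : Set where
  atom : (R : Fin (numRel σ)) → Vec (Fin n) (arity σ R) → Formula σ n
  _≐_  : Fin n → Fin n → Formula σ n
  ¬'_  : Formula σ n → Formula σ n
  _∧'_ : Formula σ n → Formula σ n → Formula σ n
  _∨'_ : Formula σ n → Formula σ n → Formula σ n
  _⇒'_ : Formula σ n → Formula σ n → Formula σ n
  ∀'_  : Formula σ (suc n) → Formula σ n
  ∃'_  : Formula σ (suc n) → Formula σ n

-- Atoms are decidable and universes finite, so satisfaction is decidable
-- and this agrees with the classical Tarski semantics.
Sat : ∀ {σ n} (𝔄 : Structure σ) → Vec (Universe 𝔄) n → Formula σ n → Set
Sat 𝔄 ρ (atom R xs) = interp 𝔄 R (map (lookup ρ) xs) ≡ true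
Sat 𝔄 ρ (x ≐ y)     = lookup ρ x ≡ lookup ρ y
Sat 𝔄 ρ (¬' φ)      = ¬ Sat 𝔄 ρ φ
Sat 𝔄 ρ (φ ∧' ψ)    = Sat 𝔄 ρ φ × Sat 𝔄 ρ ψ
Sat 𝔄 ρ (φ ∨' ψ)    = Sat 𝔄 ρ φ ⊎ Sat 𝔄 ρ ψ
Sat 𝔄 ρ (φ ⇒' ψ)    = Sat 𝔄 ρ φ → Sat 𝔄 ρ ψ
Sat 𝔄 ρ (∀' φ)      = (a : Universe 𝔄) → Sat 𝔄 (a ∷ ρ) φ
Sat 𝔄 ρ (∃' φ)      = ∃[ a ] Sat 𝔄 (a ∷ ρ) φ

-- The variables x, y of φ(x,y) are the indices 0, 1.
DefinedRel : ∀ {σ} (𝔄 : Structure σ) → Formula σ 2 → Rel (Universe 𝔄) 0ℓ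
DefinedRel 𝔄 φ u v = Sat 𝔄 (u ∷ v ∷ []) φ

------------------------------------------------------------------------
-- Graphs and tree-depth

record SimpleGraph (n : ℕ) : Set₁ where
  field
    Adj        : Rel (Fin n) 0ℓ
    adj-sym    : ∀ {x y} → Adj x y → Adj y x
    adj-irrefl : ∀ {x} → ¬ Adj x x

open SimpleGraph public

gaifman : ∀ {σ} (𝔄 : Structure σ) → SimpleGraph (size 𝔄)
gaifman {σ} 𝔄 = record
  { Adj        = λ x y → x ≢ y × ∃[ R ] ∃[ t ] (interp 𝔄 R t ≡ true × x Vec.∈ t × y Vec.∈ t)
  ; adj-sym    = λ { (x≢y , R , t , r , p , q) → (λ e → x≢y (sym e)) , R , t , r , q , p }
  ; adj-irrefl = λ { (x≢x , _) → x≢x refl }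
  }

-- In what follows, a vertex set S stands for the induced subgraph G[S].
Connected : ∀ {n} → SimpleGraph n → Subset n → Set
Connected G S =
  Nonempty S × (∀ {u v} → u ∈ S → v ∈ S → Star (λ x y → x ∈ S × y ∈ S × Adj G x y) u v)

Component : ∀ {n} → SimpleGraph n → Subset n → Subset n → Set
Component G S K =
  K ⊆ S × Connected G K × (∀ K' → K' ⊆ S → Connected G K' → K ⊆ K' → K' ⊆ K)

IsMin IsMax : {I : Set} → (I → Set) → (I → ℕ) → ℕ → Set
IsMin P f m = (∃[ i ] (P i × f i ≡ m)) × (∀ i → P i → m ≤ f i)
IsMax P f m = (∃[ i ] (P i × f i ≡ m)) × (∀ i → P i → f i ≤ m)

-- TreeDepth G S k is the graph of the recursive definition td(G[S]) = k;
-- f lists the tree-depths of the smaller graphs. The empty graph has no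
-- tree-depth (it is not connected, and IsMax fails without components).
data TreeDepth {n : ℕ} (G : SimpleGraph n) : Subset n → ℕ → Set where
  td-single       : ∀ {S} → ∣ S ∣ ≡ 1 → TreeDepth G S 1
  td-connected    : ∀ {S m} → Connected G S → 1 < ∣ S ∣ →
                    (f : Fin n → ℕ) → (∀ r → r ∈ S → TreeDepth G (S - r) (f r)) →
                    IsMin (_∈ S) f m → TreeDepth G S (suc m)
  td-disconnected : ∀ {S m} → ¬ Connected G S →
                    (f : Subset n → ℕ) → (∀ K → Component G S K → TreeDepth G K (f K)) →
                    IsMax (Component G S) f m → TreeDepth G S m

HasTreeDepth≤ : ∀ {σ} → Structure σ → ℕ → Set
HasTreeDepth≤ 𝔄 d = ∃[ k ] (TreeDepth (gaifman 𝔄) ⊤ k × k ≤ d)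

ClassSize≤ : ∀ {n} → Rel (Fin n) 0ℓ → Fin n → ℕ → Set
ClassSize≤ _∼_ u k = ∃[ C ] ((∀ v → v ∈ C ⇔ u ∼ v) × ∣ C ∣ ≤ k)

------------------------------------------------------------------------
-- Rooted trees on a quotient
--
-- The node set is the quotient N/≈ of a finite set N, and x ≼ y reads
-- "[x] is an ancestor of [y]" (every node being an ancestor of itself).
-- The ancestor relations of finite rooted forests are exactly the finite
-- partial orders in which the ancestors of any node form a chain.
-- IsPartialOrder includes compatibility of ≼ with ≈.

record IsRootedForest {N : Set} (_≈_ _≼_ : Rel N 0ℓ) : Set where
  field
    isPartialOrder : IsPartialOrder _≈_ _≼_
    ancestorsChain : ∀ {x y z} → x ≼ z → y ≼ z → x ≼ y ⊎ y ≼ x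

record IsRootedTree {N : Set} (_≈_ _≼_ : Rel N 0ℓ) : Set where
  field
    isRootedForest : IsRootedForest _≈_ _≼_
    root           : N
    root-ancestor  : ∀ x → root ≼ x

Parent : {N : Set} (_≈_ _≼_ : Rel N 0ℓ) → Rel N 0ℓ
Parent _≈_ _≼_ x y = Strict _≈_ _≼_ x y × (∀ z → x ≼ z → z ≼ y → z ≈ x ⊎ z ≈ y)

-- Depth counted in edges: a downward path has at most k + 1 nodes.
Depth≤ : {N : Set} (_≈_ _≼_ : Rel N 0ℓ) → ℕ → Set
Depth≤ {N} _≈_ _≼_ k = (p : List N) → Linked (Parent _≈_ _≼_) p → length p ≤ suc k

-- Tree-decompositions whose tree lives on N/≈; Bag t v says that v lies in
-- the bag of the node [t]. Steps along ≈ in a path stay at the same node.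
record IsTreeDecomposition {n : ℕ} (G : SimpleGraph n) {N : Set}
         (_≈_ _≼_ : Rel N 0ℓ) (Bag : REL N (Fin n) 0ℓ) : Set where
  field
    isRootedTree : IsRootedTree _≈_ _≼_
    bag-resp     : ∀ {s t v} → s ≈ t → Bag s v → Bag t v
    edge-covered : ∀ {u v} → Adj G u v → ∃[ t ] (Bag t u × Bag t v)
    nonempty     : ∀ v → ∃[ t ] Bag t v
    connected    : ∀ v {s t} → Bag s v → Bag t v →
                   Star (λ x y → Bag x v × Bag y v ×
                           (x ≈ y ⊎ Parent _≈_ _≼_ x y ⊎ Parent _≈_ _≼_ y x)) s t

-- The bag {v : [v] is an ancestor of [t]}, and its extension to an added
-- root ⊥₋, whose bag is empty.
AncestorBag : ∀ {n} → Rel (Fin n) 0ℓ → REL (Fin n) (Fin n) 0ℓ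
AncestorBag _≼_ t v = v ≼ t

AncestorBag₋ : ∀ {n} → Rel (Fin n) 0ℓ → REL (Fin n ₋) (Fin n) 0ℓ
AncestorBag₋ _≼_ ⊥₋    v = ⊥
AncestorBag₋ _≼_ [ t ] v = AncestorBag _≼_ t v

{-# OPTIONS --safe #-}
-- Write td for tree-depth. In a connected graph of tree-depth k + 1 call a vertex
-- a root if deleting it lowers the tree-depth. There is a root, and the number of
-- roots is bounded: a graph of td > k and with paths of bounded length contains
-- a set of bounded size that already induces td > k, and every root lies in it.
-- Repeatedly deleting all roots and passing to components therefore gives, after
-- at most d rounds, a canonical elimination forest whose nodes are bounded sets of
-- vertices. Paths in a graph of tree-depth at most d can be shortened to a
-- length depending only on d, so all of this is first-order definable.

module Submission where

open import Defs
open import Data.Bool using () renaming (_≟_ to _≟ᵇ_)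
open import Data.Empty using (⊥-elim)
open import Data.Fin using (Fin; zero; suc; _↑ˡ_; _↑ʳ_; toℕ; fromℕ<)
open import Data.Fin.Properties using (_≟_; any?; all?; ¬∀⟶∃¬; toℕ-fromℕ<)
open import Data.Fin.Subset as Sub using (Subset; ∣_∣; inside; outside; ⊤)
open import Data.Fin.Subset.Properties using (∣p∣≤∣x∷p∣; ∣⊥∣≡0; ∈⊤; p⊆q⇒∣p∣≤∣q∣; x∈p∧x≢y⇒x∈p-y; x∈p⇒∣p-x∣<∣p∣) renaming (_∈?_ to _Sub∈?_)
open import Data.List using (List; []; _∷_; length; _++_; concatMap; allFin)
open import Data.List.Membership.Propositional using (_∈_)
open import Data.List.Membership.Propositional.Properties using (∈-allFin; ∈-++⁺ˡ; ∈-++⁺ʳ; ∈-concatMap⁺)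
open import Data.List.Properties using (length-++)
open import Data.List.Relation.Unary.All as All using (All; []; _∷_)
open import Data.List.Relation.Unary.All.Properties using (++⁺)
open import Data.List.Relation.Unary.Any as Any using (here; there)
open import Data.List.Relation.Unary.Linked using (Linked; []; [-]; _∷_)
open import Data.Nat using (ℕ; zero; suc; _+_; _*_; _≤_; _<_; z≤n; s≤s; _≤′_; ≤′-refl; ≤′-step)
open import Data.Nat.Properties using (≤-refl; ≤-antisym; ≤-trans; ≤-reflexive; ≤-total; ≤-pred; _≤?_; ≰⇒>; <⇒≤; <⇒≱; ≤⇒≤′; m≤n⇒m<n∨m≡n; m<n⇒m<1+n; m≤m+n; m≤n+m; +-suc; +-identityʳ; +-mono-≤; +-monoˡ-≤; +-monoʳ-≤; *-mono-≤; *-monoˡ-≤)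
open import Data.Product using (∃; ∃-syntax; Σ-syntax; _×_; _,_; proj₁; proj₂)
open import Data.Product.Function.NonDependent.Propositional using (_×-⇔_)
open import Data.Sum as Sum using (_⊎_; inj₁; inj₂)
open import Data.Sum.Function.Propositional using (_⊎-⇔_)
open import Data.Unit using (tt)
open import Data.Vec as Vec using (Vec; []; _∷_; _[_]≔_; tabulate; lookup)
import Data.Vec.Membership.Propositional as VecMem
open import Data.Vec.Membership.Propositional.Properties using (∈-lookup)
open import Data.Vec.Properties using (lookup∘tabulate; []=⇒lookup; lookup⇒[]=; []≔-updates; []≔-minimal; lookup-++ˡ; lookup-++ʳ; tabulate-∘; tabulate-cong; tabulate∘lookup)
open import Data.Vec.Relation.Unary.Any using (index)
open import Data.Vec.Relation.Unary.Any.Properties using (lookup-index)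
open import Function using (id; _∘_)
open import Function.Bundles using (_⇔_; mk⇔; Equivalence)
open import Function.Construct.Composition using (_⇔-∘_)
open import Function.Construct.Identity using (⇔-id)
open import Function.Related.TypeIsomorphisms using (→-cong-⇔; ¬-cong-⇔)
open import Level using (0ℓ)
open import Relation.Binary.Construct.Add.Infimum.Equality as Eq₋ using (_≈₋_)
open import Relation.Binary.Construct.Add.Infimum.NonStrict as Ord₋ using (_≤₋_; ⊥₋≤_; ≤₋-isPartialOrder)
open import Relation.Binary.Construct.Closure.ReflexiveTransitive using (Star; ε; _◅_; _◅◅_; gmap; reverse)
open import Relation.Binary.Construct.NonStrictToStrict using () renaming (_<_ to Strict)
open import Relation.Binary.Core using (Rel)
open import Relation.Binary.PropositionalEquality using (_≡_; _≢_; refl; sym; subst; cong; trans)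
open import Relation.Binary.Structures using (IsEquivalence; IsPartialOrder)
open import Relation.Nullary using (¬_; Dec; yes; no; contradiction)
open import Relation.Nullary.Construct.Add.Infimum using (_₋; ⊥₋; [_])
open import Relation.Nullary.Decidable using (_×-dec_; _⊎-dec_; _→-dec_; ¬?; map; map′; does; dec-true)
open import Relation.Unary using (Pred; U; _⊆_; Decidable)

-- Definable relations are invariant under automorphisms, so a formula cannot single out one root;
-- all candidates have to go at once. This does no harm, since deleting further vertices never
-- raises the tree-depth, and it makes whole sets of roots the nodes, which is why a bound on the
-- number of roots is the crux. Adjacent vertices become comparable because an edge keeps its ends
-- in one component until one of them is deleted. The exact tree-depth need not be named by a
-- formula: among the implications `TD (suc k) P → TD k (P ∖ r)` only the one at the exact depth has
-- content. For smaller `k` the premise fails, for larger `k` the conclusion holds anyway.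

-- Numerical bounds.

-- Counts edges: `walkBound k + 1` to enter the deleted vertex for the first time,
-- `suc (walkBound k)` to leave it for good.
walkBound : ℕ → ℕ
walkBound zero    = 0
walkBound (suc k) = (walkBound k + 1) + suc (walkBound k)

-- In the successor case `m` counts a first obstruction, `m * m` one more obstruction for each of
-- its vertices, `suc ℓ` the vertices of a path joining each of these to a base vertex, and the
-- outer `suc` the base vertex.
obstructionSize : ℕ → ℕ → ℕ
obstructionSize ℓ zero    = 1
obstructionSize ℓ (suc k) = suc ((m + m * m) * suc ℓ)
  where m = obstructionSize ℓ k

obstructionSize-mono : ∀ ℓ {k m} → k ≤ m → obstructionSize ℓ k ≤ obstructionSize ℓ m
obstructionSize-mono ℓ {m = m} z≤n     = positive m
  where
  positive : ∀ m → 1 ≤ obstructionSize ℓ m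
  positive zero    = s≤s z≤n
  positive (suc m) = s≤s z≤n
obstructionSize-mono ℓ (s≤s h) = s≤s (*-monoˡ-≤ (suc ℓ) (+-mono-≤ o (*-mono-≤ o o)))
  where o = obstructionSize-mono ℓ h

-- Decidable predicates and lists as finite subsets.

subsetOf : ∀ {n} {P : Pred (Fin n) 0ℓ} → Decidable P → Subset n
subsetOf P? = tabulate (λ x → does (P? x))

∈-subsetOf : ∀ {n} {P : Pred (Fin n) 0ℓ} (P? : Decidable P) x → x Sub.∈ subsetOf P? ⇔ P x
∈-subsetOf {P = P} P? x = mk⇔ to from
  where
  to : x Sub.∈ subsetOf P? → P x
  to h with P? x | trans (sym (lookup∘tabulate (λ x → does (P? x)) x)) ([]=⇒lookup h)
  ... | yes p | _ = p
  from : P x → x Sub.∈ subsetOf P?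
  from p = lookup⇒[]= x _ (trans (lookup∘tabulate _ x) (dec-true (P? x) p))

∣p[i]≔inside∣≤1+∣p∣ : ∀ {n} (p : Subset n) i → ∣ p [ i ]≔ inside ∣ ≤ suc ∣ p ∣
∣p[i]≔inside∣≤1+∣p∣ (s ∷ p)       zero    = s≤s (∣p∣≤∣x∷p∣ s p)
∣p[i]≔inside∣≤1+∣p∣ (inside ∷ p)  (suc i) = s≤s (∣p[i]≔inside∣≤1+∣p∣ p i)
∣p[i]≔inside∣≤1+∣p∣ (outside ∷ p) (suc i) = ∣p[i]≔inside∣≤1+∣p∣ p i

fromList : ∀ {n} → List (Fin n) → Subset n
fromList []       = Sub.⊥
fromList (x ∷ xs) = fromList xs [ x ]≔ inside

∈-fromList : ∀ {n} {x : Fin n} {xs} → x ∈ xs → x Sub.∈ fromList xs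
∈-fromList {xs = y ∷ ys} (here refl) = []≔-updates (fromList ys) y
∈-fromList {x = x} {y ∷ ys} (there x∈) with x ≟ y
... | yes refl = []≔-updates (fromList ys) y
... | no x≢y   = []≔-minimal (fromList ys) x y x≢y (∈-fromList x∈)

∣fromList∣≤length : ∀ {n} (xs : List (Fin n)) → ∣ fromList xs ∣ ≤ length xs
∣fromList∣≤length {n} [] = ≤-reflexive (∣⊥∣≡0 n)
∣fromList∣≤length (x ∷ xs) = ≤-trans (∣p[i]≔inside∣≤1+∣p∣ (fromList xs) x) (s≤s (∣fromList∣≤length xs))

∣p∣≤length : ∀ {n} {p : Subset n} {xs} → (∀ {x} → x Sub.∈ p → x ∈ xs) → ∣ p ∣ ≤ length xs
∣p∣≤length {xs = xs} h = ≤-trans (p⊆q⇒∣p∣≤∣q∣ (λ x∈ → ∈-fromList (h x∈))) (∣fromList∣≤length xs)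

∣p∣≡1⇒x≡y : ∀ {n} {p : Subset n} {x y} → ∣ p ∣ ≡ 1 → x Sub.∈ p → y Sub.∈ p → x ≡ y
∣p∣≡1⇒x≡y {p = p} {x} {y} e x∈ y∈ with x ≟ y
... | yes x≡y = x≡y
... | no x≢y with ≤-trans (s≤s (≤-trans (s≤s z≤n) (x∈p⇒∣p-x∣<∣p∣ (x∈p∧x≢y⇒x∈p-y x∈ x≢y))))
                          (≤-trans (x∈p⇒∣p-x∣<∣p∣ y∈) (≤-reflexive e))
... | s≤s ()

-- The interface between graph theory and logic: a preorder whose symmetric part becomes `∼`, so
-- that no quotient has to be formed. `⊑-reverse` makes the level rise along strict pairs, which
-- bounds the depth.
record LevelledOrder {n : ℕ} (G : SimpleGraph n) (_⊑_ : Rel (Fin n) 0ℓ) (d c : ℕ) : Set where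
  field
    ⊑-refl      : ∀ u → u ⊑ u
    ⊑-trans     : ∀ {u v w} → u ⊑ v → v ⊑ w → u ⊑ w
    ⊑-chain     : ∀ {u v w} → u ⊑ w → v ⊑ w → u ⊑ v ⊎ v ⊑ u
    level       : Fin n → ℕ
    level<d     : ∀ u → level u < d
    ⊑-reverse   : ∀ {u v} → u ⊑ v → level v ≤ level u → v ⊑ u
    comparable  : ∀ {u v} → Adj G u v → u ⊑ v ⊎ v ⊑ u
    least       : Connected G ⊤ → ∃[ r ] (∀ u → r ⊑ u)
    small-class : ∀ u → ∃[ H ] (length H ≤ c × (∀ {v} → u ⊑ v → v ⊑ u → v ∈ H))

-- Reachability and tree-depth of induced subgraphs.

module Elimination {n : ℕ} (G : SimpleGraph n) (adj? : ∀ x y → Dec (Adj G x y)) where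

  V : Set
  V = Fin n

  VSet : Set₁
  VSet = Pred V 0ℓ

  infixl 6 _∖_
  _∖_ : VSet → V → VSet
  (P ∖ r) x = P x × x ≢ r

  data Reach (P : VSet) : V → V → Set where
    stop : ∀ {a} → P a → Reach P a a
    step : ∀ {a b c} → P a → Adj G a b → Reach P b c → Reach P a c

  reach-start : ∀ {P a b} → Reach P a b → P a
  reach-start (stop p)     = p
  reach-start (step p _ _) = p

  reach-end : ∀ {P a b} → Reach P a b → P b
  reach-end (stop p)     = p
  reach-end (step _ _ w) = reach-end w

  reach-mono : ∀ {P Q a b} → P ⊆ Q → Reach P a b → Reach Q a b
  reach-mono P⊆Q (stop p)     = stop (P⊆Q p)
  reach-mono P⊆Q (step p e w) = step (P⊆Q p) e (reach-mono P⊆Q w)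

  reach-trans : ∀ {P a b c} → Reach P a b → Reach P b c → Reach P a c
  reach-trans (stop _)     w = w
  reach-trans (step p e v) w = step p e (reach-trans v w)

  reach-snoc : ∀ {P a b c} → Reach P a b → Adj G b c → P c → Reach P a c
  reach-snoc w e p = reach-trans w (step (reach-end w) e (stop p))

  reach-sym : ∀ {P a b} → Reach P a b → Reach P b a
  reach-sym (stop p)     = stop p
  reach-sym (step p e w) = reach-snoc (reach-sym w) (adj-sym G e) p

  reach-within : ∀ {P a b} → Reach P a b → Reach (Reach P a) a b
  reach-within w = go (stop (reach-start w)) w
    where
    go : ∀ {P a b c} → Reach P a b → Reach P b c → Reach (Reach P a) b c
    go v (stop _)     = stop v
    go v (step p e w) = step v e (go (reach-snoc v e (reach-start w)) w)

  -- TD k P says that the subgraph induced by P has tree-depth at most k.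
  -- The deleted y is not required to lie in P, which makes TD k antitone in P.
  TD : ℕ → VSet → Set
  TD zero    P = ∀ x → ¬ P x
  TD (suc k) P = ∀ x → P x → ∃[ y ] TD k (Reach P x ∖ y)

  td-anti : ∀ k {P Q} → P ⊆ Q → TD k Q → TD k P
  td-anti zero    P⊆Q t x p = t x (P⊆Q p)
  td-anti (suc k) P⊆Q t x p with t x (P⊆Q p)
  ... | y , s = y , td-anti k (λ { (w , x≢y) → reach-mono P⊆Q w , x≢y }) s

  td-suc : ∀ k {P} → TD k P → TD (suc k) P
  td-suc zero    t x p = ⊥-elim (t x p)
  td-suc (suc k) t x p with t x p
  ... | y , s = y , td-suc k s

  td-mono : ∀ {k m P} → k ≤ m → TD k P → TD m P
  td-mono k≤m = go (≤⇒≤′ k≤m)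
    where
    go : ∀ {k m P} → k ≤′ m → TD k P → TD m P
    go ≤′-refl     t = t
    go (≤′-step l) t = td-suc _ (go l t)

  td-length : ∀ xs → TD (length xs) (_∈ xs)
  td-length []       x ()
  td-length (y ∷ xs) x _ = y , td-anti (length xs) tail (td-length xs)
    where
    tail : Reach (_∈ y ∷ xs) x ∖ y ⊆ (_∈ xs)
    tail (w , z≢y) with reach-end w
    ... | here z≡y = ⊥-elim (z≢y z≡y)
    ... | there z∈ = z∈

  -- Walks of bounded length, and decidability.

  -- At most `l` edges. The recursion on `l` mirrors the formula `walkF` connective by connective.
  Walk : VSet → ℕ → V → V → Set
  Walk P zero    a b = P a × a ≡ b
  Walk P (suc l) a b = P a × (a ≡ b ⊎ ∃[ c ] (Adj G a c × Walk P l c b))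

  walk⇒reach : ∀ {P} l {a b} → Walk P l a b → Reach P a b
  walk⇒reach zero    (p , refl)               = stop p
  walk⇒reach (suc l) (p , inj₁ refl)          = stop p
  walk⇒reach (suc l) (p , inj₂ (_ , e , w)) = step p e (walk⇒reach l w)

  walk-anti : ∀ {P Q} l {a b} → P ⊆ Q → Walk P l a b → Walk Q l a b
  walk-anti zero    s (p , e)                = s p , e
  walk-anti (suc l) s (p , inj₁ e)           = s p , inj₁ e
  walk-anti (suc l) s (p , inj₂ (c , e , w)) = s p , inj₂ (c , e , walk-anti l s w)

  walk-≤ : ∀ {P l m a b} → l ≤ m → Walk P l a b → Walk P m a b
  walk-≤ {m = zero}  z≤n     w                      = w
  walk-≤ {m = suc _} z≤n     (p , e)                = p , inj₁ e
  walk-≤             (s≤s _) (p , inj₁ e)           = p , inj₁ e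
  walk-≤             (s≤s h) (p , inj₂ (c , e , w)) = p , inj₂ (c , e , walk-≤ h w)

  walk-trans : ∀ {P} k l {a b c} → Walk P k a b → Walk P l b c → Walk P (k + l) a c
  walk-trans zero    l (_ , refl)             v = v
  walk-trans (suc k) l (_ , inj₁ refl)        v = walk-≤ (m≤n+m l (suc k)) v
  walk-trans (suc k) l (p , inj₂ (c , e , w)) v = p , inj₂ (c , e , walk-trans k l w v)

  Hits : VSet → V → V → Set
  Hits P y a = P y × (a ≡ y ⊎ ∃[ c ] (Reach (P ∖ y) a c × Adj G c y))

  avoid-or-hit : ∀ {P a b} y → Reach P a b → Reach (P ∖ y) a b ⊎ Hits P y a
  avoid-or-hit {a = a} y w with a ≟ y
  avoid-or-hit y w | yes refl = inj₂ (reach-start w , inj₁ refl)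
  avoid-or-hit y (stop p) | no a≢y = inj₁ (stop (p , a≢y))
  avoid-or-hit y (step p e w) | no a≢y with avoid-or-hit y w
  ... | inj₁ v                        = inj₁ (step (p , a≢y) e v)
  ... | inj₂ (q , inj₁ refl)          = inj₂ (q , inj₂ (_ , stop (p , a≢y) , e))
  ... | inj₂ (q , inj₂ (c , v , e′)) = inj₂ (q , inj₂ (c , step (p , a≢y) e v , e′))

  -- A walk either avoids y, or its part before the first visit to y and the
  -- part after the last one do; both are short by induction.
  shorten : ∀ k {P a b} → TD k P → Reach P a b → Walk P (walkBound k) a b
  shorten zero    {a = a}     t w = ⊥-elim (t a (reach-start w))
  shorten (suc k) {P} {a} {b} t w with t a (reach-start w)
  ... | y , s = helper (avoid-or-hit y v) (avoid-or-hit y (reach-sym v))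
    where
    l = walkBound k
    v : Reach (Reach P a) a b
    v = reach-within w
    within : Reach P a ∖ y ⊆ P
    within (u , _) = reach-end u
    short : ∀ {c d} → Reach (Reach P a ∖ y) c d → Walk P l c d
    short u = walk-anti l within (shorten k s u)
    toY : Hits (Reach P a) y a → Walk P (l + 1) a y
    toY (q , inj₁ refl)        = walk-≤ (m≤n+m 1 l) (reach-end q , inj₁ refl)
    toY (q , inj₂ (c , u , e)) =
      walk-trans l 1 (short u) (within (reach-end u) , inj₂ (y , e , reach-end q , refl))
    fromY : Hits (Reach P a) y b → Walk P (suc l) y b
    fromY (q , inj₁ refl)        = reach-end q , inj₁ refl
    fromY (q , inj₂ (c , u , e)) = reach-end q , inj₂ (c , adj-sym G e , short (reach-sym u))
    direct : Reach (Reach P a ∖ y) a b → Walk P ((l + 1) + suc l) a b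
    direct u = walk-≤ (≤-trans (m≤m+n l 1) (m≤m+n (l + 1) (suc l))) (short u)
    helper : Reach (Reach P a ∖ y) a b ⊎ Hits (Reach P a) y a →
             Reach (Reach P a ∖ y) b a ⊎ Hits (Reach P a) y b →
             Walk P ((l + 1) + suc l) a b
    helper (inj₁ u) _        = direct u
    helper (inj₂ h) (inj₁ u) = direct (reach-sym u)
    helper (inj₂ h) (inj₂ g) = walk-trans (l + 1) (suc l) (toY h) (fromY g)

  -- No depth bound is assumed here, so the trivial one is used: a graph on `n` vertices has
  -- tree-depth at most `n`. This makes reachability decidable in every decidable set.
  reach⇒walk : ∀ P {a b} → Reach P a b → Walk P (walkBound (length (allFin n))) a b
  reach⇒walk P = shorten _ (td-anti _ (λ {x} _ → ∈-allFin x) (td-length (allFin n)))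

  walk? : ∀ {P} → Decidable P → ∀ l a b → Dec (Walk P l a b)
  walk? P? zero    a b = P? a ×-dec (a ≟ b)
  walk? P? (suc l) a b =
    P? a ×-dec ((a ≟ b) ⊎-dec any? (λ c → adj? a c ×-dec walk? P? l c b))

  reach? : ∀ {P} → Decidable P → ∀ a b → Dec (Reach P a b)
  reach? {P} P? a b = map′ (walk⇒reach _) (reach⇒walk P) (walk? P? _ a b)

  ∖? : ∀ {P} → Decidable P → ∀ r → Decidable (P ∖ r)
  ∖? P? r x = P? x ×-dec ¬? (x ≟ r)

  td? : ∀ k {P} → Decidable P → Dec (TD k P)
  td? zero    P? = all? (λ x → ¬? (P? x))
  td? (suc k) P? = all? (λ x → P? x →-dec any? (λ y → td? k (∖? (reach? P? x) y)))

  -- Components, and the recursive tree-depth compared with `TD`.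

  reach⇒star : ∀ {P a b} → Reach P a b → Star (λ x y → P x × P y × Adj G x y) a b
  reach⇒star (stop _)     = ε
  reach⇒star (step p e w) = (p , reach-start w , e) ◅ reach⇒star w

  star⇒reach : ∀ {P a b} → P a → Star (λ x y → P x × P y × Adj G x y) a b → Reach P a b
  star⇒reach p ε                 = stop p
  star⇒reach p ((_ , q , e) ◅ w) = step p e (star⇒reach q w)

  td-components : ∀ m {P} → (∀ x → P x → TD m (Reach P x)) → TD m P
  td-components zero    h x p = h x p x (stop p)
  td-components (suc m) h x p with h x p x (stop p)
  ... | y , s = y , td-anti m (λ { (w , z≢y) → reach-within w , z≢y }) s

  module _ (S : Subset n) (x : V) (x∈S : x Sub.∈ S) where

    private
      inS? : Decidable (Reach (Sub._∈ S) x)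
      inS? = reach? (_Sub∈? S) x

    componentOf : Subset n
    componentOf = subsetOf inS?

    ∈-component : ∀ {z} → Reach (Sub._∈ S) x z → z Sub.∈ componentOf
    ∈-component = Equivalence.from (∈-subsetOf inS? _)

    component-reach : ∀ {z} → z Sub.∈ componentOf → Reach (Sub._∈ S) x z
    component-reach = Equivalence.to (∈-subsetOf inS? _)

    componentOf-component : Component G S componentOf
    componentOf-component =
      (λ z∈ → reach-end (component-reach z∈)) ,
      ((x , ∈-component (stop x∈S)) , λ u∈ v∈ → reach⇒star (reach-trans (back u∈) (forth v∈))) ,
      λ K′ K′⊆S conn K⊆K′ z∈ →
        let x∈K′ = K⊆K′ (∈-component (stop x∈S))
        in ∈-component (reach-mono K′⊆S (star⇒reach x∈K′ (proj₂ conn x∈K′ z∈)))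
      where
      forth : ∀ {z} → z Sub.∈ componentOf → Reach (Sub._∈ componentOf) x z
      forth z∈ = reach-mono ∈-component (reach-within (component-reach z∈))
      back : ∀ {z} → z Sub.∈ componentOf → Reach (Sub._∈ componentOf) z x
      back z∈ = reach-sym (forth z∈)

  -- In the connected case the minimising `r` is the vertex to delete; in the disconnected case each
  -- component is bounded by the maximum, and `TD` is tested on components.
  treeDepth⇒td : ∀ {S k} → TreeDepth G S k → TD k (Sub._∈ S)
  treeDepth⇒td (td-single e) x x∈ = x , λ { z (w , z≢x) → z≢x (∣p∣≡1⇒x≡y e (reach-end w) x∈) }
  treeDepth⇒td (td-connected {S} {m} _ _ f h ((r , r∈ , fr≡m) , _)) x x∈ =
    r , td-anti m (λ { (w , z≢r) → x∈p∧x≢y⇒x∈p-y (reach-end w) z≢r })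
          (subst (λ k → TD k (Sub._∈ (S Sub.- r))) fr≡m (treeDepth⇒td (h r r∈)))
  treeDepth⇒td {S} (td-disconnected {m = m} _ f h (_ , max)) = td-components m λ x x∈ →
    let K = componentOf S x x∈
        c = componentOf-component S x x∈
    in td-mono (max K c) (td-anti (f K) (∈-component S x x∈) (treeDepth⇒td (h K c)))

  -- Obstructions of bounded size.

  length-concatMap-≤ : ∀ {m} (f : V → List V) xs → (∀ x → length (f x) ≤ m) →
                       length (concatMap f xs) ≤ length xs * m
  length-concatMap-≤ f []       h = z≤n
  length-concatMap-≤ f (x ∷ xs) h =
    ≤-trans (≤-reflexive (length-++ (f x))) (+-mono-≤ (h x) (length-concatMap-≤ f xs h))

  all-concatMap : ∀ {P : VSet} {f : V → List V} → (∀ x → All P (f x)) → ∀ xs → All P (concatMap f xs)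
  all-concatMap h []       = []
  all-concatMap h (x ∷ xs) = ++⁺ (h x) (all-concatMap h xs)

  trace : ∀ {P} l {a b} → Walk P l a b →
          ∃[ ps ] (length ps ≤ suc l × All P ps × Reach (_∈ ps) a b)
  trace zero    {a} (p , refl)             = a ∷ [] , s≤s z≤n , p ∷ [] , stop (here refl)
  trace (suc l) {a} (p , inj₁ refl)        = a ∷ [] , s≤s z≤n , p ∷ [] , stop (here refl)
  trace (suc l) {a} (p , inj₂ (c , e , w)) with trace l w
  ... | ps , len , ps⊆P , r = a ∷ ps , s≤s len , p ∷ ps⊆P , step (here refl) e (reach-mono there r)

  module Obstruction (ℓ : ℕ) (short : ∀ {P a b} → Reach P a b → Walk P ℓ a b) where

    -- `TD` is tested component by component, so obstructions put into one list count together only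
    -- once joined: each `z` gets its own short path from `x`.
    connect : ∀ {P x} zs → All (Reach P x) zs →
              ∃[ H ] (length H ≤ length zs * suc ℓ × All P H × All (Reach (_∈ H) x) zs)
    connect []       []       = [] , z≤n , [] , []
    connect (z ∷ zs) (r ∷ rs) with trace ℓ (short r) | connect zs rs
    ... | ps , l , ps⊆P , w | H , l′ , H⊆P , ws =
      ps ++ H , ≤-trans (≤-reflexive (length-++ ps)) (+-mono-≤ l l′) , ++⁺ ps⊆P H⊆P ,
      reach-mono ∈-++⁺ˡ w ∷ All.map (reach-mono (∈-++⁺ʳ ps)) ws

    -- H consists of an obstruction H₁ to k, of an obstruction to k avoiding r
    -- for each r ∈ H₁, and of short paths connecting them: deleting any single
    -- vertex leaves an obstruction to k.
    obstruction : ∀ k {P} → Decidable P → ¬ TD k P →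
                  ∃[ H ] (length H ≤ obstructionSize ℓ k × All P H × ¬ TD k (_∈ H))
    obstruction zero {P} P? ¬t with ¬∀⟶∃¬ n (λ x → ¬ P x) (λ x → ¬? (P? x)) ¬t
    ... | x , ¬¬p with P? x
    ... | yes p = x ∷ [] , s≤s z≤n , p ∷ [] , λ t → t x (here refl)
    ... | no ¬p = ⊥-elim (¬¬p ¬p)
    obstruction (suc k) {P} P? ¬t
      with ¬∀⟶∃¬ n (λ x → P x → ∃[ y ] TD k (Reach P x ∖ y))
             (λ x → P? x →-dec any? (λ y → td? k (∖? (reach? P? x) y))) ¬t
    ... | x , ¬s = H , len , H⊆P , ¬td
      where
      p : P x
      p with P? x
      ... | yes p = p
      ... | no ¬p = ⊥-elim (¬s (λ p → ⊥-elim (¬p p)))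
      C : VSet
      C = Reach P x
      ih : ∀ y → ∃[ H ] (length H ≤ obstructionSize ℓ k × All (C ∖ y) H × ¬ TD k (_∈ H))
      ih y = obstruction k (∖? (reach? P? x) y) (λ t → ¬s (λ _ → y , t))
      -- `¬s` rules out every deleted vertex, hence also tree-depth at most `k` for the component
      -- itself; `x` is an arbitrary choice of deleted vertex.
      ih₁ = obstruction k (reach? P? x) (λ t → ¬s (λ _ → x , td-anti k proj₁ t))
      H₁ = proj₁ ih₁
      H₂ : V → List V
      H₂ y = proj₁ (ih y)
      zs = H₁ ++ concatMap H₂ H₁
      conn = connect zs (++⁺ (proj₁ (proj₂ (proj₂ ih₁)))
               (all-concatMap (λ y → All.map proj₁ (proj₁ (proj₂ (proj₂ (ih y))))) H₁))
      -- `x` is listed explicitly as the point at which `TD (suc k)` is tested below.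
      H = x ∷ proj₁ conn
      len : length H ≤ obstructionSize ℓ (suc k)
      len = s≤s (≤-trans (proj₁ (proj₂ conn)) (*-monoˡ-≤ (suc ℓ)
        (≤-trans (≤-reflexive (length-++ H₁)) (+-mono-≤ l₁
          (≤-trans (length-concatMap-≤ H₂ H₁ (λ y → proj₁ (proj₂ (ih y)))) (*-monoˡ-≤ _ l₁))))))
        where l₁ = proj₁ (proj₂ ih₁)
      H⊆P : All P H
      H⊆P = p ∷ proj₁ (proj₂ (proj₂ conn))
      reached : ∀ {z} → z ∈ zs → Reach (_∈ H) x z
      reached z∈ = reach-mono there (All.lookup (proj₂ (proj₂ (proj₂ conn))) z∈)
      ¬td : ¬ TD (suc k) (_∈ H)
      ¬td t with t x (here refl)
      ... | y , s with Any.any? (y ≟_) H₁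
      ... | yes y∈ = proj₂ (proj₂ (proj₂ (ih y))) (td-anti k avoid s)
        where
        avoid : (_∈ H₂ y) ⊆ Reach (_∈ H) x ∖ y
        avoid z∈ = reached (∈-++⁺ʳ H₁ (∈-concatMap⁺ H₂ (Any.map (λ { refl → z∈ }) y∈))) ,
                   proj₂ (All.lookup (proj₁ (proj₂ (proj₂ (ih y)))) z∈)
      ... | no y∉ = proj₂ (proj₂ (proj₂ ih₁)) (td-anti k avoid s)
        where
        avoid : (_∈ H₁) ⊆ Reach (_∈ H) x ∖ y
        avoid z∈ = reached (∈-++⁺ˡ z∈) , λ { refl → y∉ z∈ }

  -- Roots.

  -- Root d P r says that deleting r from P lowers the tree-depth of P, provided
  -- that the latter is at most d.
  Root : ℕ → VSet → VSet
  Root zero    P r = P r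
  Root (suc j) P r = Root j P r × (TD (suc j) P → TD j (P ∖ r))

  root-∈ : ∀ j {P r} → Root j P r → P r
  root-∈ zero    p       = p
  root-∈ (suc j) (q , _) = root-∈ j q

  root-td : ∀ {j P r k} → Root j P r → k < j → TD (suc k) P → TD k (P ∖ r)
  root-td {suc j} (q , h) (s≤s k≤j) t with m≤n⇒m<n∨m≡n k≤j
  ... | inj₁ k<j  = root-td q k<j t
  ... | inj₂ refl = h t

  root-intro : ∀ j {P r} → P r → (∀ k → TD (suc k) P → TD k (P ∖ r)) → Root j P r
  root-intro zero    p h = p
  root-intro (suc j) p h = root-intro j p h , h j

  root-cong : ∀ j {P Q r} → P ⊆ Q → Q ⊆ P → Root j P r → Root j Q r
  root-cong zero    f g p       = f p
  root-cong (suc j) f g (q , h) =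
    root-cong j f g q ,
    λ t → td-anti j (λ { (x , x≢r) → g x , x≢r }) (h (td-anti (suc j) f t))

  root? : ∀ j {P} → Decidable P → Decidable (Root j P)
  root? zero    P? r = P? r
  root? (suc j) P? r = root? j P? r ×-dec (td? (suc j) P? →-dec td? j (∖? P? r))

  exact-td : ∀ d {P x} → Decidable P → P x → TD d P → ∃[ k ] (k < d × TD (suc k) P × ¬ TD k P)
  exact-td zero    {x = x} P? p t = ⊥-elim (t x p)
  exact-td (suc d) P? p t with td? d P?
  ... | no ¬t = d , ≤-refl , t , ¬t
  ... | yes s with exact-td d P? p s
  ... | k , k<d , u = k , m<n⇒m<1+n k<d , u

  -- At the exact depth `suc k`, the witness is the vertex `y` that `TD (suc k) P` deletes from the
  -- component of `x`, which is all of `P`.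
  root-exists : ∀ d {P x} → Decidable P → P x → (∀ {a} → P a → Reach P x a) → TD d P → ∃ (Root d P)
  root-exists d {P} {x} P? p conn t with exact-td d P? p t
  ... | k , _ , s , ¬s = choose (P? y)
    where
    y = proj₁ (s x p)
    P∖y : TD k (P ∖ y)
    P∖y = td-anti k (λ { (q , z≢y) → conn q , z≢y }) (proj₂ (s x p))
    lowers : ∀ {r} → TD k (P ∖ r) → ∀ m → TD (suc m) P → TD m (P ∖ r)
    lowers h m u with k ≤? m
    ... | yes k≤m = td-mono k≤m h
    ... | no k≰m  = ⊥-elim (¬s (td-mono (≰⇒> k≰m) u))
    choose : Dec (P y) → ∃ (Root d P)
    choose (yes q) = y , root-intro d q (lowers P∖y)
    -- `y` may lie outside `P`; deleting it then removes nothing, and any vertex of `P` serves as a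
    -- root.
    choose (no ¬q) = x , root-intro d p (lowers (td-anti k
                           (λ { (q , _) → q , λ { refl → ¬q q } }) P∖y))

  -- Layers and the ancestor preorder.

  -- The vertices surviving i rounds of deleting all roots and passing to the
  -- component of v; empty once v itself has been deleted.
  Layer : ℕ → ℕ → V → VSet
  Layer d zero    v = Reach U v
  Layer d (suc i) v = Reach (λ z → Layer d i v z × ¬ Root d (Layer d i v) z) v

  layer? : ∀ d i v → Decidable (Layer d i v)
  layer? d zero    v = reach? (λ _ → yes tt) v
  layer? d (suc i) v = reach? (λ z → layer? d i v z ×-dec ¬? (root? d (layer? d i v) z)) v

  module Layers (d : ℕ) (td : TD d U) where

    layer-down : ∀ i {v} → Layer d (suc i) v ⊆ Layer d i v
    layer-down i w = proj₁ (reach-end w)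

    layer-unrooted : ∀ i {v z} → Layer d (suc i) v z → ¬ Root d (Layer d i v) z
    layer-unrooted i w = proj₂ (reach-end w)

    layer-≤ : ∀ {i j v} → i ≤ j → Layer d j v ⊆ Layer d i v
    layer-≤ {i} h w = go (≤⇒≤′ h) w
      where
      go : ∀ {j v} → i ≤′ j → Layer d j v ⊆ Layer d i v
      go ≤′-refl         w = w
      go (≤′-step {j} h) w = go h (layer-down j w)

    -- The next layers of `u` and `v` omit the roots of their current ones. Identifying these roots
    -- by `root-cong` takes both inclusions between the current layers, hence the mutual induction.
    layer-trans : ∀ i {u v} → Layer d i u v → Layer d i v ⊆ Layer d i u
    layer-sym   : ∀ i {u v} → Layer d i u v → Layer d i v u

    layer-trans zero    w v = reach-trans w v
    layer-trans (suc i) w v = reach-trans w (reach-mono (λ { (x , ¬r) →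
      layer-trans i (layer-down i w) x ,
      λ r → ¬r (root-cong d (layer-trans i (layer-sym i (layer-down i w)))
                            (layer-trans i (layer-down i w)) r) }) v)
    layer-sym zero    w = reach-sym w
    layer-sym (suc i) w = reach-mono (λ { (x , ¬r) →
      layer-trans i (layer-sym i (layer-down i w)) x ,
      λ r → ¬r (root-cong d (layer-trans i (layer-down i w))
                            (layer-trans i (layer-sym i (layer-down i w))) r) }) (reach-sym w)

    root-transport : ∀ i {u v r} → Layer d i u v → Root d (Layer d i u) r → Root d (Layer d i v) r
    root-transport i w = root-cong d (layer-trans i (layer-sym i w)) (layer-trans i w)

    layer-self : ∀ i {v x} → Layer d i v x → Layer d i v v
    layer-self i w = layer-trans i w (layer-sym i w)

    layer-connected : ∀ i {v a} → Layer d i v a → Reach (Layer d i v) v a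
    layer-connected zero    w = reach-within w
    layer-connected (suc i) w = reach-within w

    layer-root : ∀ i {v x} → TD d (Layer d i v) → Layer d i v x → ∃ (Root d (Layer d i v))
    layer-root i t w = root-exists d (layer? d i _) (layer-self i w) (layer-connected i) t

    layer-td≤d : ∀ i v → TD d (Layer d i v)
    layer-td≤d i v = td-anti d (λ _ → tt) td

    -- Each round costs one: a nonempty layer has a root `r`, and the next layer avoids `r` along
    -- with all other roots.
    layer-td : ∀ i j v → i + j ≡ d → TD j (Layer d i v)
    layer-td zero    j v refl = layer-td≤d 0 v
    layer-td (suc i) j v e with layer? d i v v
    ... | no ∉ = td-mono {0} z≤n (λ x w → ∉ (layer-self i (layer-down i w)))
    ... | yes w with layer-root i (layer-td≤d i v) w
    ... | r , root = td-anti j (λ {x} u → layer-down i u , λ { refl → layer-unrooted i u root })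
                       (root-td root (≤-trans (m≤n+m (suc j) i) (≤-reflexive e′)) (layer-td i (suc j) v e′))
      where e′ = trans (+-suc i j) e

    -- u belongs to the node that is removed from the layers of v in round i.
    At : ℕ → V → V → Set
    At i u v = Root d (Layer d i v) u

    at? : ∀ i u v → Dec (At i u v)
    at? i u v = root? d (layer? d i v) u

    at-layer : ∀ i {u v} → At i u v → Layer d i v u
    at-layer i r = root-∈ d r

    -- A vertex never deleted would survive into its layer `d`, which is empty by `layer-td` with
    -- `j = 0`.
    reflexive-level : ∀ u → ∃[ i ] (i < d × At i u u)
    reflexive-level u with survive d
      where
      survive : ∀ i → Layer d i u u ⊎ ∃[ j ] (j < i × At j u u)
      survive zero = inj₁ (stop tt)
      survive (suc i) with survive i
      ... | inj₂ (j , j<i , a) = inj₂ (j , m<n⇒m<1+n j<i , a)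
      ... | inj₁ w with at? i u u
      ... | yes a = inj₂ (i , ≤-refl , a)
      ... | no ¬a = inj₁ (stop (w , ¬a))
    ... | inj₂ h = h
    ... | inj₁ w = ⊥-elim (layer-td d 0 u (+-identityʳ d) u w)

    level : V → ℕ
    level u = proj₁ (reflexive-level u)

    level<d : ∀ u → level u < d
    level<d u = proj₁ (proj₂ (reflexive-level u))

    at-level : ∀ u → At (level u) u u
    at-level u = proj₂ (proj₂ (reflexive-level u))

    at-bound : ∀ {i j u v} → At i u u → Layer d j v u → j ≤ i
    at-bound {i} {j} {u} a w with j ≤? i
    ... | yes h = h
    ... | no ¬h = ⊥-elim (layer-unrooted i (layer-≤ (≰⇒> ¬h) (layer-trans j (layer-sym j w) w)) a)

    at-self : ∀ i {u v} → At i u v → At i u u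
    at-self i a = root-transport i (at-layer i a) a

    -- Two rounds that both delete `u` bound each other by `at-bound`. Hence a disjunction over all
    -- rounds, which a formula can express, agrees with `Ancestor`, which fixes the round.
    at-unique : ∀ {i u v} → At i u v → i ≡ level u
    at-unique {i} {u} a = ≤-antisym (at-bound (at-level u) (at-layer i (at-self i a)))
                                    (at-bound (at-self i a) (at-layer (level u) (at-level u)))

    Ancestor : V → V → Set
    Ancestor u v = At (level u) u v

    ancestor-refl : ∀ u → Ancestor u u
    ancestor-refl = at-level

    at-trans : ∀ {i j u v w} → At i u v → At j v w → At i u w
    at-trans {i} {j} {u} {v} {w} a b =
      root-transport i (layer-sym i (layer-≤ i≤j (at-layer j b))) a
      where
      i≤j : i ≤ j
      i≤j = at-bound (at-self j b) (layer-self i (at-layer i a))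

    ancestor-trans : ∀ {u v w} → Ancestor u v → Ancestor v w → Ancestor u w
    ancestor-trans {u} {v} = at-trans {level u} {level v}

    ancestor-level : ∀ {u v} → Ancestor u v → level u ≤ level v
    ancestor-level {u} {v} a = at-bound (at-level v) (layer-self (level u) (at-layer (level u) a))

    ancestor-reverse : ∀ {u v} → Ancestor u v → level v ≤ level u → Ancestor v u
    ancestor-reverse {u} {v} a h with ≤-antisym (ancestor-level a) h
    ... | e = root-transport (level v) (subst (λ i → Layer d i v u) e (at-layer (level u) a)) (at-level v)

    ancestor-≤ : ∀ {x y z} → level x ≤ level y → Ancestor x z → Ancestor y z → Ancestor x y
    ancestor-≤ {x} {y} h a b = root-transport (level x) (layer-≤ h (at-layer (level y) b)) a

    ancestor-chain : ∀ {x y z} → Ancestor x z → Ancestor y z → Ancestor x y ⊎ Ancestor y x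
    ancestor-chain {x} {y} a b =
      Sum.map (λ h → ancestor-≤ h a b) (λ h → ancestor-≤ h b a) (≤-total (level x) (level y))

    -- The edge itself joins two surviving neighbours, so they are never separated and the one
    -- deleted no later is an ancestor of the other.
    layer-adj : ∀ i {u v} → Adj G u v → Layer d i u u → Layer d i v v → Layer d i u v
    layer-adj zero    e w x = step tt e (stop tt)
    layer-adj (suc i) e w x = step (reach-start w) e (stop
      (uv , λ r → layer-unrooted i x (root-transport i uv r)))
      where uv = layer-adj i e (layer-down i w) (layer-down i x)

    adj-≤ : ∀ {u v} → level u ≤ level v → Adj G u v → Ancestor u v
    adj-≤ {u} {v} h e = root-transport i
      (layer-adj i e (at-layer i (at-level u)) (layer-≤ h (at-layer (level v) (at-level v)))) (at-level u)
      where i = level u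

    adj-comparable : ∀ {u v} → Adj G u v → Ancestor u v ⊎ Ancestor v u
    adj-comparable {u} {v} e =
      Sum.map (λ h → adj-≤ h e) (λ h → adj-≤ h (adj-sym G e)) (≤-total (level u) (level v))

    short : ∀ {P a b} → Reach P a b → Walk P (walkBound d) a b
    short = shorten d (td-anti d (λ _ → tt) td)

    open Obstruction (walkBound d) short

    -- A root avoiding an obstruction would leave the tree-depth unchanged.
    few-roots : ∀ i v → ∃[ H ] (length H ≤ obstructionSize (walkBound d) d × (∀ {u} → At i u v → u ∈ H))
    few-roots i v with layer? d i v v
    ... | no ∉ = [] , z≤n , λ a → ⊥-elim (∉ (layer-self i (at-layer i a)))
    ... | yes w with exact-td d (layer? d i v) w (layer-td≤d i v)
    ... | k , k<d , t , ¬t with obstruction k (layer? d i v) ¬t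
    ... | H , len , H⊆ , ¬s = H , ≤-trans len (obstructionSize-mono _ (<⇒≤ k<d)) , member
      where
      member : ∀ {u} → At i u v → u ∈ H
      member {u} a with Any.any? (u ≟_) H
      ... | yes u∈ = u∈
      ... | no u∉  = ⊥-elim (¬s (td-anti k (λ z∈ → All.lookup H⊆ z∈ , λ { refl → u∉ z∈ }) (root-td a k<d t)))

    root-ancestor-of-all : ∀ v → (∀ x → Reach U v x) → ∃[ r ] (∀ x → Ancestor r x)
    root-ancestor-of-all v conn with layer-root 0 (layer-td≤d 0 v) (stop tt)
    ... | r , a with at-unique {0} a
    ... | e = r , λ x → subst (λ i → At i r x) e (root-transport 0 (conn x) a)

    small-class : ∀ u → ∃[ H ] (length H ≤ obstructionSize (walkBound d) d ×
                                (∀ {v} → Ancestor u v → Ancestor v u → v ∈ H))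
    small-class u with few-roots (level u) u
    ... | H , len , H∋ = H , len , λ {v} a b →
      H∋ (subst (λ i → At i v u) (≤-antisym (ancestor-level b) (ancestor-level a)) b)

    levelledOrder : LevelledOrder G Ancestor d (obstructionSize (walkBound d) d)
    levelledOrder = record
      { ⊑-refl      = ancestor-refl
      ; ⊑-trans     = λ {u} {v} {w} → ancestor-trans {u} {v} {w}
      ; ⊑-chain     = λ {u} {v} {w} → ancestor-chain {u} {v} {w}
      ; level       = level
      ; level<d     = level<d
      ; ⊑-reverse   = λ {u} {v} → ancestor-reverse {u} {v}
      ; comparable  = λ {u} {v} → adj-comparable {u} {v}
      ; least       = λ { ((v , _) , conn) →
          root-ancestor-of-all v (λ x → reach-mono (λ _ → tt) (star⇒reach ∈⊤ (conn ∈⊤ ∈⊤))) }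
      ; small-class = small-class
      }

    at⇔ancestor : ∀ u v → (∃[ i ] At (toℕ {d} i) u v) ⇔ Ancestor u v
    at⇔ancestor u v = mk⇔ to from
      where
      to : ∃[ i ] At (toℕ {d} i) u v → Ancestor u v
      to (i , a) = subst (λ j → At j u v) (at-unique {toℕ i} {u} {v} a) a
      from : Ancestor u v → ∃[ i ] At (toℕ {d} i) u v
      from a = fromℕ< (level<d u) , subst (λ j → At j u v) (sym (toℕ-fromℕ< (level<d u))) a

-- Decidability of satisfaction.

∃-⇔ : ∀ {A : Set} {B C : A → Set} → (∀ x → B x ⇔ C x) → ∃ B ⇔ ∃ C
∃-⇔ h = mk⇔ (λ { (x , b) → x , Equivalence.to (h x) b }) (λ { (x , c) → x , Equivalence.from (h x) c })

∀-⇔ : ∀ {A : Set} {B C : A → Set} → (∀ x → B x ⇔ C x) → (∀ x → B x) ⇔ (∀ x → C x)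
∀-⇔ h = mk⇔ (λ f x → Equivalence.to (h x) (f x)) (λ f x → Equivalence.from (h x) (f x))

≡⇒⇔ : ∀ {A B : Set} → A ≡ B → A ⇔ B
≡⇒⇔ refl = ⇔-id _

sat? : ∀ {σ n} (𝔄 : Structure σ) (ρ : Vec (Universe 𝔄) n) φ → Dec (Sat 𝔄 ρ φ)
sat? 𝔄 ρ (atom R xs) = interp 𝔄 R (Vec.map (lookup ρ) xs) ≟ᵇ _
sat? 𝔄 ρ (x ≐ y)     = lookup ρ x ≟ lookup ρ y
sat? 𝔄 ρ (¬' φ)      = ¬? (sat? 𝔄 ρ φ)
sat? 𝔄 ρ (φ ∧' ψ)    = sat? 𝔄 ρ φ ×-dec sat? 𝔄 ρ ψ
sat? 𝔄 ρ (φ ∨' ψ)    = sat? 𝔄 ρ φ ⊎-dec sat? 𝔄 ρ ψ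
sat? 𝔄 ρ (φ ⇒' ψ)    = sat? 𝔄 ρ φ →-dec sat? 𝔄 ρ ψ
sat? 𝔄 ρ (∀' φ)      = all? (λ a → sat? 𝔄 (a ∷ ρ) φ)
sat? 𝔄 ρ (∃' φ)      = any? (λ a → sat? 𝔄 (a ∷ ρ) φ)

-- The formulae.

module _ {σ : Signature} where

  ⋁ : ∀ k {m} → (Fin k → Formula σ m) → Formula σ m
  -- Falsum, also over the empty universe, where the universal statement holds vacuously.
  ⋁ zero    φ = ¬' (∀' (zero ≐ zero))
  ⋁ (suc k) φ = φ zero ∨' ⋁ k (φ ∘ suc)

  ∃^ : ∀ k {m} → Formula σ (k + m) → Formula σ m
  ∃^ zero    φ = φ
  ∃^ (suc k) φ = ∃^ k (∃' φ)

  adjF : ∀ {m} → Fin m → Fin m → Formula σ m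
  adjF {m} x y = (¬' (x ≐ y)) ∧' ⋁ (numRel σ) λ R →
    ∃^ (arity σ R) (atom R (tabulate (_↑ˡ m)) ∧' (occurs R x ∧' occurs R y))
    where
    occurs : ∀ R → Fin m → Formula σ (arity σ R + m)
    occurs R z = ⋁ (arity σ R) (λ i → (arity σ R ↑ʳ z) ≐ (i ↑ˡ m))

  -- A definable set with m parameters, given as a formula in one further
  -- variable that can be written down in every context containing the parameters.
  DefSet : ℕ → Set
  DefSet m = ∀ {m′} → (Fin m → Fin m′) → Fin m′ → Formula σ m′

  weaken : ∀ {m m′} → (Fin m → Fin m′) → DefSet m → DefSet m′
  weaken f S g = S (g ∘ f)

  infixl 6 _∖F_
  _∖F_ : ∀ {m} → DefSet m → Fin m → DefSet m
  (S ∖F r) g z = S g z ∧' (¬' (z ≐ g r))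

  walkF : ∀ {m} → DefSet m → ℕ → Fin m → Fin m → Formula σ m
  walkF S zero    a b = S id a ∧' (a ≐ b)
  walkF S (suc l) a b =
    S id a ∧' ((a ≐ b) ∨' (∃' (adjF (suc a) zero ∧' walkF (weaken suc S) l zero (suc b))))

  module _ (d : ℕ) where

    -- Tree-depth does not grow in induced subgraphs, so the one bound `walkBound d` serves at every
    -- level of nesting.
    reachF : ∀ {m} → DefSet m → Fin m → DefSet m
    reachF S a g z = walkF (weaken g S) (walkBound d) (g a) z

    tdF : ∀ {m} → ℕ → DefSet m → Formula σ m
    tdF zero    S = ∀' (¬' S suc zero)
    tdF (suc k) S = ∀' (S suc zero ⇒'
      -- Under both binders, index 1 is the start of the component and index 0 the deleted vertex.
      (∃' (tdF k (reachF (weaken suc (weaken suc S)) (suc zero) ∖F zero))))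

    rootF : ∀ {m} → ℕ → DefSet m → Fin m → Formula σ m
    rootF zero    S r = S id r
    rootF (suc j) S r = rootF j S r ∧' (tdF (suc j) S ⇒' tdF j (S ∖F r))

    layerF : ∀ {m} → ℕ → Fin m → DefSet m
    layerF zero    v = reachF (λ _ z → z ≐ z) v
    layerF (suc i) v =
      reachF (λ g z → layerF i v g z ∧' (¬' rootF d (weaken g (layerF i v)) z)) v

    ancestorF : ∀ {m} → Fin m → Fin m → Formula σ m
    ancestorF u v = ⋁ d (λ i → rootF d (layerF (toℕ i) v) u)

-- Correctness of the formulae.

module Semantics {σ : Signature} (𝔄 : Structure σ) where

  Env : ℕ → Set
  Env = Vec (Universe 𝔄)

  sat-⋁ : ∀ k {m} (ρ : Env m) φ → Sat 𝔄 ρ (⋁ k φ) ⇔ (∃[ i ] Sat 𝔄 ρ (φ i))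
  sat-⋁ zero    ρ φ = mk⇔ (λ h → contradiction (λ _ → refl) h) λ ()
  sat-⋁ (suc k) ρ φ = mk⇔
    (λ { (inj₁ s) → zero , s
       ; (inj₂ s) → let (i , t) = Equivalence.to (sat-⋁ k ρ (φ ∘ suc)) s in suc i , t })
    (λ { (zero , s)  → inj₁ s
       ; (suc i , s) → inj₂ (Equivalence.from (sat-⋁ k ρ (φ ∘ suc)) (i , s)) })

  sat-∃^ : ∀ k {m} (ρ : Env m) φ → Sat 𝔄 ρ (∃^ k φ) ⇔ (∃[ t ] Sat 𝔄 (t Vec.++ ρ) φ)
  sat-∃^ zero    ρ φ = mk⇔ (λ s → [] , s) (λ { ([] , s) → s })
  sat-∃^ (suc k) ρ φ = mk⇔
    (λ s → let (t , a , s′) = Equivalence.to (sat-∃^ k ρ (∃' φ)) s in a ∷ t , s′)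
    (λ { (a ∷ t , s) → Equivalence.from (sat-∃^ k ρ (∃' φ)) (t , a , s) })

  sat-adj : ∀ {m} (ρ : Env m) x y → Sat 𝔄 ρ (adjF x y) ⇔ Adj (gaifman 𝔄) (lookup ρ x) (lookup ρ y)
  sat-adj {m} ρ x y = ⇔-id _ ×-⇔ (sat-⋁ (numRel σ) ρ _ ⟫ ∃-⇔ λ R →
    sat-∃^ (arity σ R) ρ _ ⟫ ∃-⇔ λ t →
    ≡⇒⇔ (cong (λ t′ → interp 𝔄 R t′ ≡ _) (tuple t)) ×-⇔ (occurs t x ×-⇔ occurs t y))
    where
    infixr 1 _⟫_
    _⟫_ : {A B C : Set} → A ⇔ B → B ⇔ C → A ⇔ C
    f ⟫ g = g ⇔-∘ f
    tuple : ∀ {k} (t : Env k) → Vec.map (lookup (t Vec.++ ρ)) (tabulate (_↑ˡ m)) ≡ t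
    tuple t = trans (sym (tabulate-∘ _ _)) (trans (tabulate-cong (lookup-++ˡ t ρ)) (tabulate∘lookup t))
    occurs : ∀ {k} (t : Env k) z →
             Sat 𝔄 (t Vec.++ ρ) (⋁ k (λ i → (k ↑ʳ z) ≐ (i ↑ˡ m))) ⇔ (lookup ρ z VecMem.∈ t)
    occurs {k} t z = sat-⋁ k (t Vec.++ ρ) _ ⟫ mk⇔
      (λ { (i , e) → subst (VecMem._∈ t)
             (trans (sym (trans e (lookup-++ˡ t ρ i))) (lookup-++ʳ t ρ z)) (∈-lookup i t) })
      (λ p → index p , trans (lookup-++ʳ t ρ z) (trans (lookup-index p) (sym (lookup-++ˡ t ρ (index p)))))

  adj? : ∀ x y → Dec (Adj (gaifman 𝔄) x y)
  adj? x y = map (sat-adj (x ∷ y ∷ []) zero (suc zero))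
                 (sat? 𝔄 (x ∷ y ∷ []) (adjF zero (suc zero)))

  open Elimination (gaifman 𝔄) adj?

  -- Quantifying over `g` and `ρ′` lets the same set formula be used under further quantifiers; only
  -- the values of the parameters must agree, and no substitution lemma is required.
  record Represents {m} (ρ : Env m) (S : DefSet {σ} m) (P : Pred (Universe 𝔄) 0ℓ) : Set where
    constructor represents
    field
      sat-at : ∀ {m′} (g : Fin m → Fin m′) (ρ′ : Env m′) →
        (∀ i → lookup ρ′ (g i) ≡ lookup ρ i) → ∀ z → Sat 𝔄 ρ′ (S g z) ⇔ P (lookup ρ′ z)

    sat-here : ∀ z → Sat 𝔄 ρ (S id z) ⇔ P (lookup ρ z)
    sat-here = sat-at id ρ (λ _ → refl)

    sat-under : ∀ a → Sat 𝔄 (a ∷ ρ) (S suc zero) ⇔ P a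
    sat-under a = sat-at suc (a ∷ ρ) (λ _ → refl) zero

  open Represents

  weaken-represents : ∀ {m m′} {ρ : Env m} {P} (S : DefSet m) → Represents ρ S P →
    (f : Fin m → Fin m′) (ρ′ : Env m′) → (∀ i → lookup ρ′ (f i) ≡ lookup ρ i) →
    Represents ρ′ (weaken f S) P
  weaken-represents S r f ρ′ e =
    represents λ g ρ″ e′ z → sat-at r (g ∘ f) ρ″ (λ i → trans (e′ (f i)) (e i)) z

  under : ∀ {m} {ρ : Env m} {P} (S : DefSet m) → Represents ρ S P →
          ∀ a → Represents (a ∷ ρ) (weaken suc S) P
  under {ρ = ρ} S r a = weaken-represents S r suc (a ∷ ρ) (λ _ → refl)

  ∖F-represents : ∀ {m} {ρ : Env m} {P} (S : DefSet m) → Represents ρ S P →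
                  ∀ x → Represents ρ (S ∖F x) (P ∖ lookup ρ x)
  ∖F-represents S r x = represents λ g ρ′ e z →
    sat-at r g ρ′ e z ×-⇔ ¬-cong-⇔ (≡⇒⇔ (cong (lookup ρ′ z ≡_) (e x)))

  sat-walk : ∀ {m} {ρ : Env m} {P} (S : DefSet m) → Represents ρ S P →
             ∀ l a b → Sat 𝔄 ρ (walkF S l a b) ⇔ Walk P l (lookup ρ a) (lookup ρ b)
  sat-walk         S r zero    a b = sat-here r a ×-⇔ ⇔-id _
  sat-walk {ρ = ρ} S r (suc l) a b = sat-here r a ×-⇔ (⇔-id _ ⊎-⇔ ∃-⇔ λ c →
    sat-adj (c ∷ ρ) (suc a) zero ×-⇔ sat-walk (weaken suc S) (under S r c) l zero (suc b))

  module _ (d : ℕ) (td : TD d U) where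

    open Layers d td using (short; At)

    -- The depth hypothesis enters here: `short` turns an arbitrary walk into one that the formula
    -- can describe.
    reachF-represents : ∀ {m} {ρ : Env m} {P} (S : DefSet m) → Represents ρ S P →
                        ∀ a → Represents ρ (reachF d S a) (Reach P (lookup ρ a))
    reachF-represents {P = P} S r a = represents λ g ρ′ e z →
      mk⇔ (subst (λ x → Reach P x _) (e a) ∘ walk⇒reach (walkBound d))
          (short ∘ subst (λ x → Reach P x _) (sym (e a)))
      ⇔-∘ sat-walk (weaken g S) (weaken-represents S r g ρ′ e) (walkBound d) (g a) z

    sat-td : ∀ {m} k {ρ : Env m} {P} (S : DefSet m) → Represents ρ S P →
             Sat 𝔄 ρ (tdF d k S) ⇔ TD k P
    sat-td zero    S r = ∀-⇔ λ x → ¬-cong-⇔ (sat-under r x)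
    sat-td (suc k) S r = ∀-⇔ λ x → →-cong-⇔ (sat-under r x) (∃-⇔ λ y →
      let S₂ = λ {m} → weaken suc (weaken suc S) {m}
          C  = λ {m} → reachF d S₂ (suc zero) {m}
          r₂ = under (weaken suc S) (under S r x) y
      in sat-td k (C ∖F zero) (∖F-represents C (reachF-represents S₂ r₂ (suc zero)) zero))

    sat-root : ∀ {m} j {ρ : Env m} {P} (S : DefSet m) → Represents ρ S P →
               ∀ x → Sat 𝔄 ρ (rootF d j S x) ⇔ Root j P (lookup ρ x)
    sat-root zero    S r x = sat-here r x
    sat-root (suc j) S r x = sat-root j S r x ×-⇔
      →-cong-⇔ (sat-td (suc j) S r) (sat-td j (S ∖F x) (∖F-represents S r x))

    layerF-represents : ∀ {m} (ρ : Env m) i v →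
                        Represents ρ (layerF d i v) (Layer d i (lookup ρ v))
    layerF-represents ρ zero    v =
      reachF-represents (λ _ z → z ≐ z) (represents λ _ _ _ _ → mk⇔ (λ _ → tt) (λ _ → refl)) v
    layerF-represents ρ (suc i) v =
      reachF-represents (λ g z → layerF d i v g z ∧' (¬' rootF d d (weaken g (layerF d i v)) z))
        (represents λ g ρ′ e z → sat-at r g ρ′ e z ×-⇔
          ¬-cong-⇔ (sat-root d (weaken g (layerF d i v)) (weaken-represents (layerF d i v) r g ρ′ e) z)) v
      where
      r : Represents ρ (layerF d i v) (Layer d i (lookup ρ v))
      r = layerF-represents ρ i v

    sat-ancestor : ∀ {m} (ρ : Env m) u v →
      Sat 𝔄 ρ (ancestorF d u v) ⇔ (∃[ i ] At (toℕ {d} i) (lookup ρ u) (lookup ρ v))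
    sat-ancestor ρ u v =
      ∃-⇔ (λ i → sat-root d (layerF d (toℕ i) v) (layerF-represents ρ (toℕ i) v) u)
      ⇔-∘ sat-⋁ d ρ _

-- Depth and tree-decompositions from a ranked forest.

depth≤-rank : ∀ {N : Set} {_≈_ _≼_ : Rel N 0ℓ} (rank : N → ℕ) {k} → (∀ x → rank x ≤ k) →
              (∀ {x y} → Strict _≈_ _≼_ x y → rank x < rank y) → Depth≤ _≈_ _≼_ k
depth≤-rank rank {k} rank≤k mono []      []  = z≤n
depth≤-rank {N} {_≈_} {_≼_} rank {k} rank≤k mono (x ∷ p) lnk =
  ≤-trans (m≤m+n _ (rank x)) (go x p lnk)
  where
  go : ∀ x p → Linked (Parent _≈_ _≼_) (x ∷ p) → length (x ∷ p) + rank x ≤ suc k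
  go x []      [-]       = s≤s (rank≤k x)
  go x (y ∷ p) (e ∷ lnk) = ≤-trans
    (≤-trans (≤-reflexive (cong suc (sym (+-suc (length p) (rank x)))))
             (+-monoʳ-≤ (length (y ∷ p)) (mono (proj₁ e))))
    (go y p lnk)

module RankedForest {n : ℕ} {_∼_ _≼_ : Rel (Fin n) 0ℓ}
  (isRootedForest : IsRootedForest _∼_ _≼_) (_≼?_ : ∀ x y → Dec (x ≼ y))
  (rank : Fin n → ℕ) (rank-mono : ∀ {x y} → Strict _∼_ _≼_ x y → rank x < rank y) where

  open IsRootedForest isRootedForest
  open IsPartialOrder isPartialOrder using (antisym; reflexive; module Eq)
    renaming (refl to ≼-refl; trans to ≼-trans; isEquivalence to ∼-isEquivalence)
  open IsEquivalence ∼-isEquivalence using () renaming (sym to ∼-sym)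

  _∼?_ : ∀ x y → Dec (x ∼ y)
  x ∼? y with x ≼? y | y ≼? x
  ... | yes a | yes b = yes (antisym a b)
  ... | no ¬a | _     = no λ e → ¬a (reflexive e)
  ... | _     | no ¬b = no λ e → ¬b (reflexive (∼-sym e))

  Step : Fin n → Rel (Fin n) 0ℓ
  Step v x y = v ≼ x × v ≼ y × (x ∼ y ⊎ Parent _∼_ _≼_ x y ⊎ Parent _∼_ _≼_ y x)

  step-sym : ∀ {v x y} → Step v x y → Step v y x
  step-sym (a , b , inj₁ e)        = b , a , inj₁ (∼-sym e)
  step-sym (a , b , inj₂ (inj₁ p)) = b , a , inj₂ (inj₂ p)
  step-sym (a , b , inj₂ (inj₂ p)) = b , a , inj₂ (inj₁ p)

  -- Either nothing lies strictly between `x` and `y`, which gives a parent step, or the interval is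
  -- split at some `z`. `fuel` bounds the rank gap, which is smaller in both halves.
  descend : ∀ fuel {v x y} → v ≼ x → x ≼ y → rank y ≤ rank x + fuel → Star (Step v) x y
  descend fuel {v} {x} {y} v≼x x≼y h with x ∼? y
  ... | yes x∼y = (v≼x , ≼-trans v≼x x≼y , inj₁ x∼y) ◅ ε
  ... | no x≁y
    with any? (λ z → (x ≼? z) ×-dec ((z ≼? y) ×-dec (¬? (x ∼? z) ×-dec ¬? (z ∼? y))))
  ... | no none = (v≼x , ≼-trans v≼x x≼y , inj₂ (inj₁ ((x≼y , x≁y) , cover))) ◅ ε
    where
    cover : ∀ z → x ≼ z → z ≼ y → z ∼ x ⊎ z ∼ y
    cover z a b with x ∼? z | z ∼? y
    ... | yes e | _     = inj₁ (∼-sym e)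
    ... | _     | yes e = inj₂ e
    ... | no e  | no e′ = ⊥-elim (none (z , a , b , e , e′))
  descend zero {x = x} _ x≼y h | no x≁y | yes _ =
    ⊥-elim (<⇒≱ (rank-mono (x≼y , x≁y)) (≤-trans h (≤-reflexive (+-identityʳ (rank x)))))
  descend (suc fuel) {x = x} {y} v≼x _ h | no _ | yes (z , x≼z , z≼y , x≁z , z≁y) =
    descend fuel v≼x x≼z (≤-pred (≤-trans (rank-mono (z≼y , z≁y)) h′)) ◅◅
    descend fuel (≼-trans v≼x x≼z) z≼y (≤-trans h′ (+-monoˡ-≤ fuel (rank-mono (x≼z , x≁z))))
    where
    h′ : rank y ≤ suc (rank x + fuel)
    h′ = ≤-trans h (≤-reflexive (+-suc (rank x) fuel))

  -- The nodes whose bags contain `v` are the descendants of `[v]`, so any two are joined through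
  -- `[v]`.
  subtree-connected : ∀ v {s t} → v ≼ s → v ≼ t → Star (Step v) s t
  subtree-connected v v≼s v≼t = reverse step-sym (path v≼s) ◅◅ path v≼t
    where
    path : ∀ {s} → v ≼ s → Star (Step v) v s
    path {s} v≼s = descend (rank s) ≼-refl v≼s (m≤n+m (rank s) (rank v))

  module _ {G : SimpleGraph n} (comparable : ∀ {u v} → Adj G u v → (u ≼ v) ⊎ (v ≼ u)) where

    treeDecomposition : IsRootedTree _∼_ _≼_ → IsTreeDecomposition G _∼_ _≼_ (AncestorBag _≼_)
    treeDecomposition tree = record
      { isRootedTree = tree
      ; bag-resp     = λ s∼t v≼s → ≼-trans v≼s (reflexive s∼t)
      ; edge-covered = cover
      ; nonempty     = λ v → v , ≼-refl
      ; connected    = subtree-connected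
      }
      where
      cover : ∀ {u v} → Adj G u v → ∃[ t ] (u ≼ t × v ≼ t)
      cover {u} {v} e with comparable e
      ... | inj₁ u≼v = v , u≼v , ≼-refl
      ... | inj₂ v≼u = u , ≼-refl , v≼u

    parent₋ : ∀ {x y} → Parent _∼_ _≼_ x y → Parent (_≈₋_ _∼_) (_≤₋_ _≼_) [ x ] [ y ]
    parent₋ ((x≼y , x≁y) , cover) =
      (Ord₋.[ x≼y ] , λ { Eq₋.[ e ] → x≁y e }) , cover₋
      where
      cover₋ : ∀ z → _≤₋_ _≼_ [ _ ] z → _≤₋_ _≼_ z [ _ ] → _≈₋_ _∼_ z [ _ ] ⊎ _≈₋_ _∼_ z [ _ ]
      cover₋ [ z ] Ord₋.[ a ] Ord₋.[ b ] = Sum.map Eq₋.[_] Eq₋.[_] (cover z a b)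

    treeDecomposition₋ : IsTreeDecomposition G (_≈₋_ _∼_) (_≤₋_ _≼_) (AncestorBag₋ _≼_)
    treeDecomposition₋ = record
      { isRootedTree = record
        { isRootedForest = record
          { isPartialOrder = ≤₋-isPartialOrder _≼_ isPartialOrder
          ; ancestorsChain = chain
          }
        ; root          = ⊥₋
        ; root-ancestor = ⊥₋≤_
        }
      ; bag-resp     = λ { Eq₋.[ s∼t ] v≼s → ≼-trans v≼s (reflexive s∼t) }
      ; edge-covered = cover
      ; nonempty     = λ v → [ v ] , ≼-refl
      ; connected    = conn
      }
      where
      chain : ∀ {x y z} → _≤₋_ _≼_ x z → _≤₋_ _≼_ y z → _≤₋_ _≼_ x y ⊎ _≤₋_ _≼_ y x
      chain (⊥₋≤ _)    _          = inj₁ (⊥₋≤ _)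
      chain Ord₋.[ _ ] (⊥₋≤ _)    = inj₂ (⊥₋≤ _)
      chain Ord₋.[ a ] Ord₋.[ b ] = Sum.map Ord₋.[_] Ord₋.[_] (ancestorsChain a b)
      cover : ∀ {u v} → Adj G u v → ∃[ t ] (AncestorBag₋ _≼_ t u × AncestorBag₋ _≼_ t v)
      cover {u} {v} e with comparable e
      ... | inj₁ u≼v = [ v ] , u≼v , ≼-refl
      ... | inj₂ v≼u = [ u ] , ≼-refl , v≼u
      lift : ∀ {v x y} → Step v x y →
             v ≼ x × v ≼ y × (_≈₋_ _∼_ [ x ] [ y ] ⊎
               Parent (_≈₋_ _∼_) (_≤₋_ _≼_) [ x ] [ y ] ⊎ Parent (_≈₋_ _∼_) (_≤₋_ _≼_) [ y ] [ x ])
      lift (a , b , inj₁ e)        = a , b , inj₁ Eq₋.[ e ]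
      lift (a , b , inj₂ (inj₁ p)) = a , b , inj₂ (inj₁ (parent₋ p))
      lift (a , b , inj₂ (inj₂ p)) = a , b , inj₂ (inj₂ (parent₋ p))
      conn : ∀ v {s t} → AncestorBag₋ _≼_ s v → AncestorBag₋ _≼_ t v →
             Star (λ x y → AncestorBag₋ _≼_ x v × AncestorBag₋ _≼_ y v ×
               (_≈₋_ _∼_ x y ⊎ Parent (_≈₋_ _∼_) (_≤₋_ _≼_) x y ⊎ Parent (_≈₋_ _∼_) (_≤₋_ _≼_) y x)) s t
      conn v {[ s ]} {[ t ]} v≼s v≼t = gmap [_] lift (subtree-connected v v≼s v≼t)

  depth≤ : ∀ {k} → (∀ x → rank x ≤ k) → Depth≤ _∼_ _≼_ k
  depth≤ h = depth≤-rank rank h rank-mono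

  -- The added root takes rank 0 and every other rank moves up by one, which the strict bound
  -- absorbs.
  depth₋≤ : ∀ {k} → (∀ x → rank x < k) → Depth≤ (_≈₋_ _∼_) (_≤₋_ _≼_) k
  depth₋≤ {k} h = depth≤-rank rank₋ bound mono
    where
    rank₋ : Fin n ₋ → ℕ
    rank₋ ⊥₋    = 0
    rank₋ [ x ] = suc (rank x)
    bound : ∀ x → rank₋ x ≤ k
    bound ⊥₋    = z≤n
    bound [ x ] = h x
    mono : ∀ {x y} → Strict (_≈₋_ _∼_) (_≤₋_ _≼_) x y → rank₋ x < rank₋ y
    mono {⊥₋}  {⊥₋}    (_ , ≉)          = ⊥-elim (≉ Eq₋.⊥₋≈⊥₋)
    mono {⊥₋}  {[ _ ]} _                = s≤s z≤n
    mono {[ _ ]}       (Ord₋.[ a ] , ≉) = s≤s (rank-mono (a , λ e → ≉ Eq₋.[ e ]))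

-- From the preorder to the defined relations.

module Quotient {n : ℕ} {G : SimpleGraph n} {_⊑_ : Rel (Fin n) 0ℓ} {d c : ℕ}
  (order : LevelledOrder G _⊑_ d c) {_≼_ _∼_ : Rel (Fin n) 0ℓ}
  (≼⇔ : ∀ u v → (u ≼ v) ⇔ (u ⊑ v)) (∼⇔ : ∀ u v → (u ∼ v) ⇔ (u ⊑ v × v ⊑ u))
  (_≼?_ : ∀ u v → Dec (u ≼ v)) (_∼?_ : ∀ u v → Dec (u ∼ v)) where

  private
    module L = LevelledOrder order
    module ≼ {u v} = Equivalence (≼⇔ u v)
    module ∼ {u v} = Equivalence (∼⇔ u v)

  ≼-trans : ∀ {u v w} → u ≼ v → v ≼ w → u ≼ w
  ≼-trans a b = ≼.from (L.⊑-trans (≼.to a) (≼.to b))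

  ∼⇒≼ : ∀ {u v} → u ∼ v → u ≼ v
  ∼⇒≼ e = ≼.from (proj₁ (∼.to e))

  ∼-sym : ∀ {u v} → u ∼ v → v ∼ u
  ∼-sym e = let (a , b) = ∼.to e in ∼.from (b , a)

  isEquivalence : IsEquivalence _∼_
  isEquivalence = record
    { refl  = ∼.from (L.⊑-refl _ , L.⊑-refl _)
    ; sym   = ∼-sym
    ; trans = λ e f → let (a , a′) = ∼.to e
                          (b , b′) = ∼.to f
                      in ∼.from (L.⊑-trans a b , L.⊑-trans b′ a′)
    }

  classSize : ∀ u → ClassSize≤ _∼_ u c
  classSize u with L.small-class u
  ... | H , len , H∋ =
    subsetOf (u ∼?_) , ∈-subsetOf (u ∼?_) , ≤-trans (∣p∣≤length member) len
    where
    member : ∀ {v} → v Sub.∈ subsetOf (u ∼?_) → v ∈ H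
    member v∈ = let (a , b) = ∼.to (Equivalence.to (∈-subsetOf (u ∼?_) _) v∈) in H∋ a b

  invariant : ∀ {u u′ v v′} → u ∼ u′ → v ∼ v′ → (u ≼ v) ⇔ (u′ ≼ v′)
  invariant e f = mk⇔ (λ a → ≼-trans (∼⇒≼ (∼-sym e)) (≼-trans a (∼⇒≼ f)))
                      (λ a → ≼-trans (∼⇒≼ e) (≼-trans a (∼⇒≼ (∼-sym f))))

  isRootedForest : IsRootedForest _∼_ _≼_
  isRootedForest = record
    { isPartialOrder = record
      { isPreorder = record
        { isEquivalence = isEquivalence
        ; reflexive     = ∼⇒≼
        ; trans         = ≼-trans
        }
      ; antisym = λ a b → ∼.from (≼.to a , ≼.to b)
      }
    ; ancestorsChain = λ a b → Sum.map ≼.from ≼.from (L.⊑-chain (≼.to a) (≼.to b))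
    }

  isRootedTree : Connected G ⊤ → IsRootedTree _∼_ _≼_
  isRootedTree conn = record
    { isRootedForest = isRootedForest
    ; root           = proj₁ (L.least conn)
    ; root-ancestor  = λ u → ≼.from (proj₂ (L.least conn) u)
    }

  comparable : ∀ {u v} → Adj G u v → (u ≼ v) ⊎ (v ≼ u)
  comparable e = Sum.map ≼.from ≼.from (L.comparable e)

  level-mono : ∀ {u v} → Strict _∼_ _≼_ u v → L.level u < L.level v
  level-mono (a , ≁) = ≰⇒> λ h → ≁ (∼.from (≼.to a , L.⊑-reverse (≼.to a) h))

  open RankedForest isRootedForest _≼?_ L.level level-mono public

  depth≤d : Depth≤ _∼_ _≼_ d
  depth≤d = depth≤ (λ u → <⇒≤ (L.level<d u))

  depth₋≤d : Depth≤ (_≈₋_ _∼_) (_≤₋_ _≼_) d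
  depth₋≤d = depth₋≤ L.level<d

-- Structures of tree-depth at most `d`.

module _ {σ : Signature} (𝔄 : Structure σ) (d : ℕ) (h : HasTreeDepth≤ 𝔄 d) where

  open Semantics 𝔄
  open Elimination (gaifman 𝔄) adj?

  td-universe : TD d U
  td-universe =
    td-mono (proj₂ (proj₂ h)) (td-anti (proj₁ h) (λ _ → ∈⊤) (treeDepth⇒td (proj₁ (proj₂ h))))

  open Layers d td-universe

  ancestorLevelled : LevelledOrder (gaifman 𝔄) Ancestor d (obstructionSize (walkBound d) d)
  ancestorLevelled = levelledOrder

  sat-Ancestor : ∀ {m} (ρ : Env m) u v →
                 Sat 𝔄 ρ (ancestorF d u v) ⇔ Ancestor (lookup ρ u) (lookup ρ v)
  sat-Ancestor ρ u v =
    at⇔ancestor (lookup ρ u) (lookup ρ v) ⇔-∘ sat-ancestor d td-universe ρ u v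

module Canonical {σ : Signature} (𝔄 : Structure σ) (d : ℕ) (h : HasTreeDepth≤ 𝔄 d) =
  Quotient (ancestorLevelled 𝔄 d h)
    {DefinedRel 𝔄 (ancestorF d zero (suc zero))}
    {DefinedRel 𝔄 (ancestorF d zero (suc zero) ∧' ancestorF d (suc zero) zero)}
    (λ u v → sat-Ancestor 𝔄 d h (u ∷ v ∷ []) zero (suc zero))
    (λ u v → sat-Ancestor 𝔄 d h (u ∷ v ∷ []) zero (suc zero) ×-⇔
             sat-Ancestor 𝔄 d h (u ∷ v ∷ []) (suc zero) zero)
    (λ u v → sat? 𝔄 (u ∷ v ∷ []) (ancestorF d zero (suc zero)))
    (λ u v → sat? 𝔄 (u ∷ v ∷ []) (ancestorF d zero (suc zero) ∧' ancestorF d (suc zero) zero))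

mainTheorem6 :
    (σ : Signature) →
    Σ[ classBound ∈ (ℕ → ℕ) ] Σ[ depthBound ∈ (ℕ → ℕ) ]
    ((d : ℕ) → 1 ≤ d →
     Σ[ ε ∈ Formula σ 2 ] Σ[ α ∈ Formula σ 2 ]
     ((𝔄 : Structure σ) → HasTreeDepth≤ 𝔄 d →
      let G   = gaifman 𝔄
          _∼_ = DefinedRel 𝔄 ε
          _≼_ = DefinedRel 𝔄 α
      in
        -- 1.
        IsEquivalence _∼_
        -- 2.
      × (∀ u → ClassSize≤ _∼_ u (classBound d))
        -- 3.
      × (∀ {u u' v v'} → u ∼ u' → v ∼ v' → (u ≼ v) ⇔ (u' ≼ v'))
        -- 4. A rooted forest, and a rooted tree if 𝔄 is connected. (For n
        -- isolated points, n large, ∼ must be equality and α is invariant under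
        -- all permutations, so no single rooted tree is definable.)
      × IsRootedForest _∼_ _≼_
      × (Connected G ⊤ → IsRootedTree _∼_ _≼_)
      × (∀ {u v} → Adj G u v → (u ≼ v) ⊎ (v ≼ u))
        -- The bounded-depth tree-decomposition: on 𝔄/∼ itself if 𝔄 is
        -- connected, and in general after adding a root with empty bag.
      × (Connected G ⊤ → IsTreeDecomposition G _∼_ _≼_ (AncestorBag _≼_))
      × Depth≤ _∼_ _≼_ (depthBound d)
      × IsTreeDecomposition G (_≈₋_ _∼_) (_≤₋_ _≼_) (AncestorBag₋ _≼_)
      × Depth≤ (_≈₋_ _∼_) (_≤₋_ _≼_) (depthBound d)))
mainTheorem6 σ =
  (λ d → obstructionSize (walkBound d) d) , (λ d → d) , λ d _ →
  ancestorF d zero (suc zero) ∧' ancestorF d (suc zero) zero , ancestorF d zero (suc zero) ,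
  λ 𝔄 h → let open Canonical 𝔄 d h in
    isEquivalence , classSize , invariant , isRootedForest , isRootedTree , comparable ,
    (λ conn → treeDecomposition comparable (isRootedTree conn)) ,
    depth≤d , treeDecomposition₋ comparable , depth₋≤d
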